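{- For all integers $n\geq 0$, $$a_{1^{2}2^{ -1}4^{ -1}}(4n)>0,\qquad a_{1^{2}2^{ -1}4^{ -1}}(4n+1)<0,\qquad a_{1^{2}2^{ -1}4^{ -1}}(4n+2)=a_{1^{2}2^{ -1}4^{ -1}}(4n+3)=0.$$
   Context: For $|q|<1$ (or as formal power series in $q$) let $f_j:=(q^j;q^j)_\infty=\prod_{k\ge 1}(1-q^{jk})$ for each positive integer $j$. The integers $a_{1^{2}2^{ -1}4^{ -1}}(n)$, $n\ge 0$, are defined by $\sum_{n=0}^\infty a_{1^{2}2^{ -1}4^{ -1}}(n)q^n=\dfrac{f_1^2}{f_2f_4}$. -}

module Defs where

open import Data.Bool.Base using (if_then_else_)
open import Data.Fin.Base using (toℕ)
open import Data.Integer.Base using (ℤ; 0ℤ; 1ℤ; _+_; _-_; _*_)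
import Data.Integer.Properties as ℤ
open import Data.Integer.Tactic.RingSolver using (solve-∀)
open import Data.Nat.Base as ℕ using (ℕ; zero; suc; NonZero; z≤n; s≤s)
import Data.Nat.Properties as ℕ
open import Relation.Nullary.Decidable using (does; dec-false)
open import Relation.Binary.PropositionalEquality
  using (_≡_; _≗_; refl; sym; trans; cong; cong₂; module ≡-Reasoning)

open import Algebra.Properties.Semiring.Sum ℤ.+-*-semiring using (sum⁺-syntax)

-- Formal power series in q over ℤ; A n is the coefficient of q^n.
Series : Set
Series = ℕ → ℤ

infixl 7 _⊛_ _⊘_
infixl 6 _⊖_
infix  8 q^_

q^_ : ℕ → Series
(q^ m) n = if does (m ℕ.≟ n) then 1ℤ else 0ℤ

_⊖_ : Series → Series → Series
(A ⊖ B) n = A n - B n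

_⊛_ : Series → Series → Series
(A ⊛ B) n = ∑[ k ≤ n ] (A (toℕ k) * B (n ℕ.∸ toℕ k))

-- What is left of A after subtracting A₀ B, divided by q; this discards no
-- term when B has constant term 1.
remainder : Series → Series → Series
remainder A B n = A (suc n) - A 0 * B (suc n)

-- Long division in ascending powers of q, giving the quotient under the same
-- assumption on B; see ⊘-inverse and ⊘-unique.
_⊘_ : Series → Series → Series
(A ⊘ B) zero    = A 0
(A ⊘ B) (suc n) = (remainder A B ⊘ B) n

-- ∏_{k=1}^{N} (1 - q^{jk})
partialProduct : ℕ → ℕ → Series
partialProduct j zero    = q^ 0
partialProduct j (suc N) = partialProduct j N ⊛ (q^ 0 ⊖ q^ (j ℕ.* suc N))

-- (q^j ; q^j)_∞. For j ≥ 1 the factors with k > n do not affect the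
-- coefficient of q^n, so the infinite product is read off coefficientwise
-- from its partial products; see f-stable.
f : (j : ℕ) → .{{NonZero j}} → Series
f j n = partialProduct j n n

-- The coefficients of f₁² / (f₂ f₄).
a : Series
a = (f 1 ⊛ f 1) ⊘ (f 2 ⊛ f 4)

⊘-inverse : ∀ A B → B 0 ≡ 1ℤ → (A ⊘ B) ⊛ B ≗ A
⊘-inverse A B B₀≡1 zero = begin
  A 0 * B 0 + 0ℤ  ≡⟨ ℤ.+-identityʳ _ ⟩
  A 0 * B 0       ≡⟨ cong (A 0 *_) B₀≡1 ⟩
  A 0 * 1ℤ        ≡⟨ ℤ.*-identityʳ _ ⟩
  A 0             ∎
  where open ≡-Reasoning
⊘-inverse A B B₀≡1 (suc n) =
  trans (cong (A 0 * B (suc n) +_) (⊘-inverse (remainder A B) B B₀≡1 n))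
        (cancel (A 0 * B (suc n)) (A (suc n)))
  where
  cancel : ∀ x y → x + (y - x) ≡ y
  cancel = solve-∀

⊘-unique : ∀ X A B → B 0 ≡ 1ℤ → X ⊛ B ≗ A → X ≗ A ⊘ B
⊘-unique X A B B₀≡1 eq = go
  where
  X₀≡A₀ : X 0 ≡ A 0
  X₀≡A₀ = begin
    X 0             ≡⟨ ℤ.*-identityʳ _ ⟨
    X 0 * 1ℤ        ≡⟨ cong (X 0 *_) B₀≡1 ⟨
    X 0 * B 0       ≡⟨ ℤ.+-identityʳ _ ⟨
    X 0 * B 0 + 0ℤ  ≡⟨ eq 0 ⟩
    A 0             ∎
    where open ≡-Reasoning

  cancel : ∀ x y → y ≡ (x + y) - x
  cancel = solve-∀

  go : X ≗ A ⊘ B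
  go zero    = X₀≡A₀
  go (suc n) = ⊘-unique (λ k → X (suc k)) (remainder A B) B B₀≡1
    (λ k → trans (cancel (X 0 * B (suc k)) _)
                 (cong₂ _-_ (eq (suc k)) (cong (_* B (suc k)) X₀≡A₀)))
    n

a-spec : a ⊛ (f 2 ⊛ f 4) ≗ f 1 ⊛ f 1
a-spec = ⊘-inverse (f 1 ⊛ f 1) (f 2 ⊛ f 4) refl

⊛-truncated-identityʳ : ∀ A C n → (∀ i → i ℕ.≤ n → C i ≡ (q^ 0) i) → (A ⊛ C) n ≡ A n
⊛-truncated-identityʳ A C zero    C≈1 = begin
  A 0 * C 0 + 0ℤ  ≡⟨ ℤ.+-identityʳ _ ⟩
  A 0 * C 0       ≡⟨ cong (A 0 *_) (C≈1 0 z≤n) ⟩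
  A 0 * 1ℤ        ≡⟨ ℤ.*-identityʳ _ ⟩
  A 0             ∎
  where open ≡-Reasoning
⊛-truncated-identityʳ A C (suc n) C≈1 = begin
  A 0 * C (suc n) + ((λ k → A (suc k)) ⊛ C) n
    ≡⟨ cong₂ _+_ (cong (A 0 *_) (C≈1 (suc n) ℕ.≤-refl))
         (⊛-truncated-identityʳ (λ k → A (suc k)) C n (λ i i≤n → C≈1 i (ℕ.m≤n⇒m≤1+n i≤n))) ⟩
  A 0 * 0ℤ + A (suc n)
    ≡⟨ cong (_+ A (suc n)) (ℤ.*-zeroʳ (A 0)) ⟩
  0ℤ + A (suc n)
    ≡⟨ ℤ.+-identityˡ _ ⟩
  A (suc n) ∎
  where open ≡-Reasoning

q^-below : ∀ {m i} → i ℕ.< m → (q^ m) i ≡ 0ℤ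
q^-below {m} {i} i<m = cong (if_then 1ℤ else 0ℤ)
  (dec-false (m ℕ.≟ i) (ℕ.>⇒≢ i<m))

f-stable : ∀ j .{{_ : NonZero j}} n d → partialProduct j (d ℕ.+ n) n ≡ f j n
f-stable j n zero    = refl
f-stable j n (suc d) = trans
  (⊛-truncated-identityʳ (partialProduct j (d ℕ.+ n)) _ n λ i i≤n →
    trans (cong ((q^ 0) i -_) (q^-below (i<jN i≤n))) (ℤ.+-identityʳ _))
  (f-stable j n d)
  where
  i<jN : ∀ {i} → i ℕ.≤ n → i ℕ.< j ℕ.* suc (d ℕ.+ n)
  i<jN i≤n = ℕ.≤-trans (s≤s (ℕ.≤-trans i≤n (ℕ.m≤n+m n d))) (ℕ.m≤n*m _ j)

{-# OPTIONS --safe #-}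

-- Gauss's identity f₁² / f₂ = ∑_{k ∈ ℤ} (−1)^k q^{k²} shows that f₁² / f₂ is
-- supported on exponents ≡ 0, 1 (mod 4), with coefficients ≥ 0 on the class 0
-- and ≤ 0 on the class 1, and starts 1 − 2q + ⋯.  Dividing by f₄ acts on each
-- residue class mod 4 separately.  There, division by 1 − q⁴ takes partial
-- sums, which makes all coefficients of the classes 0 and 1 strictly positive,
-- respectively negative; division by 1 − q^{4k} with k ≥ 2 preserves this.
--
-- Gauss's identity follows from a finite identity of Shanks' type, which
-- holds in any commutative ring and needs no division:
--   (∑_{|k| ≤ n} (−1)^k x^{k²}) ∏_{i=1}^n (1 + xⁱ)
--     = ∑_{j=0}^n (−1)^j x^{(n+1)j} ∏_{i=0}^{j−1} (1 + xⁱ) ∏_{i=j+1}^n (1 − xⁱ).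
-- Modulo x^{n+1} only the term j = 0 survives on the right.

module Submission where

open import Defs
open import Algebra.Bundles using (CommutativeRing)
import Algebra.Construct.Pointwise as Pointwise
import Algebra.Properties.Ring as RingProperties
import Algebra.Properties.Semiring.Exp as Exp
import Algebra.Properties.Semiring.Mult.TCOptimised as Mult
import Algebra.Solver.Ring as RingSolver
open import Algebra.Solver.Ring.AlmostCommutativeRing
  using (fromCommutativeRing; _-Raw-AlmostCommutative⟶_)
open import Data.Bool.Base using (true; false; if_then_else_)
open import Data.Fin.Base using (zero; suc)
open import Data.Integer.Base as ℤ using (ℤ; -[1+_]; 0ℤ; 1ℤ; _≤_; _<_; _>_; +≤+; +<+; -<+)
import Data.Integer.Properties as ℤ
import Data.Integer.Tactic.RingSolver as ℤ
open import Data.Maybe.Base as Maybe using ()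
open import Data.Nat.Base as ℕ using (ℕ; zero; suc; z≤n; s≤s; NonZero)
open import Data.Nat.DivMod using (_%_; _divMod_; result; [m+kn]%n≡m%n; m<n⇒m%n≡m)
open import Data.Nat.Induction using (<-rec)
import Data.Nat.Properties as ℕ
import Data.Nat.Tactic.RingSolver as ℕ
open import Data.Product.Base using (∃; _,_)
open import Function.Base using (_∘_)
open import Relation.Binary.PropositionalEquality as ≡
  using (_≡_; _≢_; _≗_; cong; cong₂; subst; module ≡-Reasoning)
import Relation.Binary.Reasoning.Setoid as SetoidReasoning
open import Relation.Nullary.Decidable using (yes; no; does; dec-false; dec⇒maybe)

-- Ring solver with integer coefficients for any commutative ring.

module IntegerCoefficients {c ℓ} (R : CommutativeRing c ℓ) where

  open CommutativeRing R
  open import Data.Integer.Base using (+_)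
  open RingProperties ring
  open Mult semiring
  open SetoidReasoning setoid

  -- The canonical ring homomorphism from ℤ. With the optimised multiples, `1 × 1#` reduces to `1#`,
  -- so solver constants match `0#` and `1#` definitionally.
  ⟦_⟧ : ℤ → Carrier
  ⟦ + n ⟧      = n × 1#
  ⟦ -[1+ n ] ⟧ = - (suc n × 1#)

  ⟦⟧-homo-⊖ : ∀ m n → ⟦ m ℤ.⊖ n ⟧ ≈ m × 1# - n × 1#
  ⟦⟧-homo-⊖ m zero = begin
    m × 1#        ≈⟨ +-identityʳ _ ⟨
    m × 1# + 0#   ≈⟨ +-congˡ -0#≈0# ⟨
    m × 1# - 0#   ∎
  ⟦⟧-homo-⊖ zero (suc n) = sym (+-identityˡ _)
  ⟦⟧-homo-⊖ (suc m) (suc n) = begin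
    ⟦ suc m ℤ.⊖ suc n ⟧                ≡⟨ cong ⟦_⟧ (ℤ.[1+m]⊖[1+n]≡m⊖n m n) ⟩
    ⟦ m ℤ.⊖ n ⟧                        ≈⟨ ⟦⟧-homo-⊖ m n ⟩
    m × 1# - n × 1#                    ≈⟨ +-congʳ (xyx⁻¹≈y 1# (m × 1#)) ⟨
    1# + m × 1# - 1# - n × 1#          ≈⟨ +-assoc _ _ _ ⟩
    1# + m × 1# + (- 1# - n × 1#)      ≈⟨ +-congˡ (-‿+-comm 1# (n × 1#)) ⟩
    1# + m × 1# - (1# + n × 1#)        ≈⟨ +-cong (1+× m 1#) (-‿cong (1+× n 1#)) ⟨
    suc m × 1# - suc n × 1#            ∎

  ⟦⟧-homo-neg : ∀ i → ⟦ ℤ.- i ⟧ ≈ - ⟦ i ⟧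
  ⟦⟧-homo-neg (+ zero)   = sym -0#≈0#
  ⟦⟧-homo-neg (+ suc n)  = refl
  ⟦⟧-homo-neg (-[1+ n ]) = sym (-‿involutive _)

  ⟦⟧-homo-+ : ∀ i j → ⟦ i ℤ.+ j ⟧ ≈ ⟦ i ⟧ + ⟦ j ⟧
  ⟦⟧-homo-+ (+ m)      (+ n)      = ×-homo-+ 1# m n
  ⟦⟧-homo-+ (+ m)      (-[1+ n ]) = ⟦⟧-homo-⊖ m (suc n)
  ⟦⟧-homo-+ (-[1+ m ]) (+ n)      = trans (⟦⟧-homo-⊖ n (suc m)) (+-comm _ _)
  ⟦⟧-homo-+ (-[1+ m ]) (-[1+ n ]) = begin
    - (suc (suc (m ℕ.+ n)) × 1#)       ≡⟨ cong ⟦_⟧ (ℤ.neg-distrib-+ (+ suc m) (+ suc n)) ⟨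
    ⟦ ℤ.- (+ suc m ℤ.+ + suc n) ⟧      ≈⟨ ⟦⟧-homo-neg (+ suc m ℤ.+ + suc n) ⟩
    - ((suc m ℕ.+ suc n) × 1#)         ≈⟨ -‿cong (×-homo-+ 1# (suc m) (suc n)) ⟩
    - (suc m × 1# + suc n × 1#)        ≈⟨ -‿+-comm _ _ ⟨
    - (suc m × 1#) - suc n × 1#        ∎

  ⟦⟧-homo-+*+ : ∀ m n → ⟦ + m ℤ.* + n ⟧ ≈ ⟦ + m ⟧ * ⟦ + n ⟧
  ⟦⟧-homo-+*+ m n = trans (reflexive (cong ⟦_⟧ (≡.sym (ℤ.pos-* m n)))) (×1-homo-* m n)

  ⟦⟧-homo-+* : ∀ m j → ⟦ + m ℤ.* j ⟧ ≈ ⟦ + m ⟧ * ⟦ j ⟧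
  ⟦⟧-homo-+* m (+ n)      = ⟦⟧-homo-+*+ m n
  ⟦⟧-homo-+* m (-[1+ n ]) = begin
    ⟦ + m ℤ.* -[1+ n ] ⟧          ≡⟨ cong ⟦_⟧ (ℤ.neg-distribʳ-* (+ m) (+ suc n)) ⟨
    ⟦ ℤ.- (+ m ℤ.* + suc n) ⟧     ≈⟨ ⟦⟧-homo-neg (+ m ℤ.* + suc n) ⟩
    - ⟦ + m ℤ.* + suc n ⟧         ≈⟨ -‿cong (⟦⟧-homo-+*+ m (suc n)) ⟩
    - (⟦ + m ⟧ * ⟦ + suc n ⟧)     ≈⟨ -‿distribʳ-* _ _ ⟩
    ⟦ + m ⟧ * ⟦ -[1+ n ] ⟧        ∎

  ⟦⟧-homo-* : ∀ i j → ⟦ i ℤ.* j ⟧ ≈ ⟦ i ⟧ * ⟦ j ⟧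
  ⟦⟧-homo-* (+ m)      j = ⟦⟧-homo-+* m j
  ⟦⟧-homo-* (-[1+ m ]) j = begin
    ⟦ -[1+ m ] ℤ.* j ⟧            ≡⟨ cong ⟦_⟧ (ℤ.neg-distribˡ-* (+ suc m) j) ⟨
    ⟦ ℤ.- (+ suc m ℤ.* j) ⟧       ≈⟨ ⟦⟧-homo-neg (+ suc m ℤ.* j) ⟩
    - ⟦ + suc m ℤ.* j ⟧           ≈⟨ -‿cong (⟦⟧-homo-+* (suc m) j) ⟩
    - (⟦ + suc m ⟧ * ⟦ j ⟧)       ≈⟨ -‿distribˡ-* _ _ ⟩
    ⟦ -[1+ m ] ⟧ * ⟦ j ⟧          ∎

  homomorphism : ℤ.+-*-rawRing -Raw-AlmostCommutative⟶ fromCommutativeRing R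
  homomorphism = record
    { ⟦_⟧    = ⟦_⟧
    ; +-homo = ⟦⟧-homo-+
    ; *-homo = ⟦⟧-homo-*
    ; -‿homo = ⟦⟧-homo-neg
    ; 0-homo = refl
    ; 1-homo = refl
    }

  -- Coefficients lie in ℤ because equality is decidable there, so terms can be cancelled even where
  -- equality in `R` is not decidable, as for series.
  module Solver = RingSolver ℤ.+-*-rawRing (fromCommutativeRing R) homomorphism
    (λ i j → Maybe.map (λ i≡j → reflexive (cong ⟦_⟧ i≡j)) (dec⇒maybe (i ℤ.≟ j)))

-- Finite form of Gauss's identity.

module Gauss {c ℓ} (R : CommutativeRing c ℓ) (x : CommutativeRing.Carrier R) where

  open CommutativeRing R
  open RingProperties ring using (-‿distribˡ-*)
  open Exp semiring using (_^_; ^-congˡ; ^-congʳ; ^-assocʳ)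
  open IntegerCoefficients.Solver R
  open SetoidReasoning setoid

  -‿^-even : ∀ y l → (- y) ^ (l ℕ.* 2) ≈ y ^ (l ℕ.* 2)
  -‿^-even y l = begin
    (- y) ^ (l ℕ.* 2)    ≈⟨ ^-congʳ (- y) (ℕ.*-comm l 2) ⟩
    (- y) ^ (2 ℕ.* l)    ≈⟨ ^-assocʳ (- y) 2 l ⟨
    ((- y) ^ 2) ^ l      ≈⟨ ^-congˡ l (solve 1 (λ y → (:- y) :^ 2 := y :^ 2) refl y) ⟩
    (y ^ 2) ^ l          ≈⟨ ^-assocʳ y 2 l ⟩
    y ^ (2 ℕ.* l)        ≈⟨ ^-congʳ y (ℕ.*-comm 2 l) ⟩
    y ^ (l ℕ.* 2)        ∎

  -- The shifted factorial (z; x)_n = (1 - z)(1 - zx)⋯(1 - zxⁿ⁻¹).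
  poch : Carrier → ℕ → Carrier
  poch z zero    = 1#
  poch z (suc n) = (1# - z) * poch (z * x) n

  poch-cong : ∀ {y z} n → y ≈ z → poch y n ≈ poch z n
  poch-cong zero    y≈z = refl
  poch-cong (suc n) y≈z = *-cong (+-congˡ (-‿cong y≈z)) (poch-cong n (*-congʳ y≈z))

  poch-last : ∀ z n → poch z (suc n) ≈ poch z n * (1# - z * x ^ n)
  poch-last z zero =
    solve 1 (λ z → (con 1ℤ :- z) :* con 1ℤ := con 1ℤ :* (con 1ℤ :- z :* con 1ℤ)) refl z
  poch-last z (suc n) = begin
    (1# - z) * poch (z * x) (suc n)                      ≈⟨ *-congˡ (poch-last (z * x) n) ⟩
    (1# - z) * (poch (z * x) n * (1# - z * x * x ^ n))
      ≈⟨ solve 4 (λ z x p y → (con 1ℤ :- z) :* (p :* (con 1ℤ :- z :* x :* y)) :=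
                              (con 1ℤ :- z) :* p :* (con 1ℤ :- z :* (x :* y)))
           refl z x (poch (z * x) n) (x ^ n) ⟩
    (1# - z) * poch (z * x) n * (1# - z * (x * x ^ n))   ∎

  -- Unfolded: ∑_{i=0}^m (−u)ⁱ (1 + z)(1 + zx)⋯(1 + zxⁱ⁻¹) · (1 − zxⁱ⁺¹)⋯(1 − zxᵐ).
  shanks : Carrier → Carrier → ℕ → Carrier
  shanks u z zero    = 1#
  shanks u z (suc m) = poch (z * x) (suc m) - (1# + z) * u * shanks u (z * x) m

  -- Replacing u by x u and m by m + 1 makes the terms of the sum telescope.  The
  -- factor z and the term (1 − z) · poch (zx) m keep the induction over the tails of
  -- the sum going; for z = 1 they disappear.
  shanks-step : ∀ u z m → u ≈ z * x ^ suc m →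
    z * shanks (x * u) z (suc m) + (1# - z) * poch (z * x) m ≈
    (1# + u) * shanks u z m + (- u) ^ suc m * poch (- z) (suc (suc m))
  shanks-step u z zero u≈zx = begin
    z * shanks (x * u) z 1 + (1# - z) * 1#
      -- Isolates `z * (x * 1#)`, which is `z * x ^ 1`, so that the hypothesis can turn it into `u`;
      -- the claim is no polynomial identity in independent z, x, u.
      ≈⟨ solve 3 (λ z x u →
           z :* ((con 1ℤ :- z :* x) :* con 1ℤ :- (con 1ℤ :+ z) :* (x :* u) :* con 1ℤ)
             :+ (con 1ℤ :- z) :* con 1ℤ
           := con 1ℤ :- z :* (z :* (x :* con 1ℤ)) :- (con 1ℤ :+ z) :* u :* (z :* (x :* con 1ℤ)))
           refl z x u ⟩
    1# - z * (z * (x * 1#)) - (1# + z) * u * (z * (x * 1#))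
      ≈⟨ +-cong (+-congˡ (-‿cong (*-congˡ u≈zx))) (-‿cong (*-congˡ u≈zx)) ⟨
    1# - z * u - (1# + z) * u * u
      ≈⟨ solve 2 (λ z u →
           con 1ℤ :- z :* u :- (con 1ℤ :+ z) :* u :* u
           := (con 1ℤ :+ u) :* con 1ℤ :+ (:- u) :* con 1ℤ :* ((con 1ℤ :+ z) :* (con 1ℤ :+ u)))
           refl z u ⟩
    (1# + u) * 1# + (- u) * 1# * ((1# + z) * (1# + u))
      ≈⟨ +-congˡ (*-congˡ (*-congˡ (+-congˡ u≈zx))) ⟩
    (1# + u) * 1# + (- u) * 1# * ((1# + z) * (1# + z * (x * 1#)))
      ≈⟨ solve 3 (λ z x u →
           (con 1ℤ :+ u) :* con 1ℤ
             :+ (:- u) :* con 1ℤ :* ((con 1ℤ :+ z) :* (con 1ℤ :+ z :* (x :* con 1ℤ)))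
           := (con 1ℤ :+ u) :* con 1ℤ
             :+ (:- u) :* con 1ℤ :* ((con 1ℤ :- (:- z)) :* ((con 1ℤ :- (:- z) :* x) :* con 1ℤ)))
           refl z x u ⟩
    (1# + u) * 1# + (- u) ^ 1 * poch (- z) 2 ∎
  shanks-step u z (suc m) u≈zx = begin
    z * (poch (z * x) (suc (suc m)) - (1# + z) * (x * u) * A) + (1# - z) * P
      ≈⟨ +-congʳ (*-congˡ (+-congʳ poch-u)) ⟩
    z * (P * (1# - u) - (1# + z) * (x * u) * A) + (1# - z) * P
      ≈⟨ solve 5 (λ z x u A T → let one = con 1ℤ; P = (one :- z :* x) :* T in
           z :* (P :* (one :- u) :- (one :+ z) :* (x :* u) :* A) :+ (one :- z) :* P
           := (one :+ u) :* P :- (one :+ z) :* u :* (z :* x :* A :+ P))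
           refl z x u A T ⟩
    (1# + u) * P - (1# + z) * u * (z * x * A + P)
      -- Passing to the tail of the sum moves one factor x from the power to z, so `u` stays fixed.
      ≈⟨ +-congˡ (-‿cong (*-congˡ (shanks-step u (z * x) m u≈zxx))) ⟩
    (1# + u) * P - (1# + z) * u * ((1# + u) * B + v * K)
      ≈⟨ solve 6 (λ z u P B v K → let one = con 1ℤ in
           (one :+ u) :* P :- (one :+ z) :* u :* ((one :+ u) :* B :+ v :* K)
           := (one :+ u) :* (P :- (one :+ z) :* u :* B) :+ (:- u) :* v :* ((one :- (:- z)) :* K))
           refl z u P B v K ⟩
    (1# + u) * (P - (1# + z) * u * B) + (- u) * v * ((1# - - z) * K)
      ≈⟨ +-congˡ (*-congˡ (*-congˡ (poch-cong (suc (suc m)) (-‿distribˡ-* z x)))) ⟩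
    (1# + u) * (P - (1# + z) * u * B) + (- u) * v * poch (- z) (suc (suc (suc m))) ∎
    where
    A = shanks (x * u) (z * x) (suc m)
    B = shanks u (z * x) m
    T = poch (z * x * x) m
    P = poch (z * x) (suc m)
    v = (- u) ^ suc m
    K = poch (- (z * x)) (suc (suc m))
    u≈zxx : u ≈ z * x * x ^ suc m
    u≈zxx = trans u≈zx (sym (*-assoc z x (x ^ suc m)))
    poch-u : poch (z * x) (suc (suc m)) ≈ P * (1# - u)
    poch-u = trans (poch-last (z * x) (suc m)) (*-congˡ (+-congˡ (-‿cong (sym u≈zxx))))

  -- (−1)ⁿ x^{n²}
  signedSquare : ℕ → Carrier
  signedSquare n = (- (x ^ n)) ^ n

  -- The terms k and −k of the sum over |k| ≤ n coincide.
  squareSum : ℕ → Carrier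
  squareSum zero    = 1#
  squareSum (suc n) = squareSum n + (signedSquare (suc n) + signedSquare (suc n))

  -- Here `poch (- x) n` is ∏_{i=1}^n (1 + xⁱ). The induction step multiplies by 1 + xⁿ⁺¹ and adds
  -- the new squares, which is `shanks-step` at z = 1, u = xⁿ⁺¹.
  squareSum-*-poch : ∀ n → squareSum n * poch (- x) n ≈ shanks (x ^ suc n) 1# n
  squareSum-*-poch zero = *-identityˡ 1#
  squareSum-*-poch (suc n) = begin
    (squareSum n + (t + t)) * poch (- x) (suc n)
      ≈⟨ distribʳ _ _ _ ⟩
    squareSum n * poch (- x) (suc n) + (t + t) * poch (- x) (suc n)
      ≈⟨ +-congʳ (*-congˡ (poch-last (- x) n)) ⟩
    squareSum n * (poch (- x) n * (1# - - x * x ^ n)) + (t + t) * poch (- x) (suc n)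
      -- The two equal new terms become the factor 1 - (-1) = 2, the leading factor of
      -- `poch (- 1#) (suc (suc n))`.
      ≈⟨ solve 6 (λ s p x y t k → let one = con 1ℤ in
            s :* (p :* (one :- (:- x) :* y)) :+ (t :+ t) :* k
            := (one :+ x :* y) :* (s :* p) :+ t :* ((one :- (:- one)) :* k))
           refl (squareSum n) (poch (- x) n) x (x ^ n) t (poch (- x) (suc n)) ⟩
    (1# + u) * (squareSum n * poch (- x) n) + t * ((1# - - 1#) * poch (- x) (suc n))
      ≈⟨ +-cong (*-congˡ (squareSum-*-poch n)) (*-congˡ (*-congˡ (poch-cong (suc n) -x≈-1x))) ⟩
    (1# + u) * shanks u 1# n + t * poch (- 1#) (suc (suc n))
      ≈⟨ shanks-step u 1# n (sym (*-identityˡ u)) ⟨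
    1# * shanks (x * u) 1# (suc n) + (1# - 1#) * poch (1# * x) n
      ≈⟨ solve 2 (λ h p → let one = con 1ℤ in one :* h :+ (one :- one) :* p := h)
           refl (shanks (x * u) 1# (suc n)) (poch (1# * x) n) ⟩
    shanks (x * u) 1# (suc n) ∎
    where
    u = x ^ suc n
    t = signedSquare (suc n)
    -x≈-1x : - x ≈ - 1# * x
    -x≈-1x = solve 1 (λ x → :- x := :- con 1ℤ :* x) refl x

  -- Every term of the sum after the first contains a factor u.
  shanks-mod : ∀ u z m → ∃ λ e → shanks u z m ≈ poch (z * x) m + u * e
  shanks-mod u z zero    = 0# , sym (trans (+-congˡ (zeroʳ u)) (+-identityʳ 1#))
  shanks-mod u z (suc m) = - ((1# + z) * shanks u (z * x) m) ,
    solve 4 (λ p z u h → p :- (con 1ℤ :+ z) :* u :* h := p :+ u :* (:- ((con 1ℤ :+ z) :* h)))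
      refl (poch (z * x) (suc m)) z u (shanks u (z * x) m)

  squareSum-mod : ∀ n → ∃ λ e → squareSum n * poch (- x) n ≈ poch x n + x ^ suc n * e
  squareSum-mod n with shanks-mod (x ^ suc n) 1# n
  ... | e , shanks≈ =
    e , trans (squareSum-*-poch n) (trans shanks≈ (+-congʳ (poch-cong n (*-identityˡ x))))

-- The commutative ring of formal power series.

open import Data.Integer.Base using (_+_; _-_; _*_; -_)
open import Data.Product.Base using (_×_)
open ≡ using (refl; sym; trans)

-- Congruence modulo qⁿ⁺¹.
_≈[_]_ : Series → ℕ → Series → Set
A ≈[ n ] B = ∀ i → i ℕ.≤ n → A i ≡ B i

≈-tail : ∀ {A B n} → A ≈[ suc n ] B → (A ∘ suc) ≈[ n ] (B ∘ suc)
≈-tail A≈B i i≤n = A≈B (suc i) (s≤s i≤n)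

≈-init : ∀ {A B n} → A ≈[ suc n ] B → A ≈[ n ] B
≈-init A≈B i i≤n = A≈B i (ℕ.m≤n⇒m≤1+n i≤n)

≈-mono : ∀ {A B m n} → m ℕ.≤ n → A ≈[ n ] B → A ≈[ m ] B
≈-mono m≤n A≈B i i≤m = A≈B i (ℕ.≤-trans i≤m m≤n)

⊛-cong-at : ∀ A A′ B B′ n → A ≈[ n ] A′ → B ≈[ n ] B′ → (A ⊛ B) n ≡ (A′ ⊛ B′) n
⊛-cong-at A A′ B B′ zero    A≈A′ B≈B′ =
  cong (_+ 0ℤ) (cong₂ _*_ (A≈A′ 0 z≤n) (B≈B′ 0 z≤n))
⊛-cong-at A A′ B B′ (suc n) A≈A′ B≈B′ =
  cong₂ _+_ (cong₂ _*_ (A≈A′ 0 z≤n) (B≈B′ (suc n) ℕ.≤-refl))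
            (⊛-cong-at (A ∘ suc) (A′ ∘ suc) B B′ n (≈-tail A≈A′) (≈-init B≈B′))

⊛-cong : ∀ {A A′ B B′} → A ≗ A′ → B ≗ B′ → A ⊛ B ≗ A′ ⊛ B′
⊛-cong A≗A′ B≗B′ n = ⊛-cong-at _ _ _ _ n (λ i _ → A≗A′ i) (λ i _ → B≗B′ i)

infixl 6 _⊕_
_⊕_ : Series → Series → Series
(A ⊕ B) n = A n + B n

⊛-distribʳ-⊕ : ∀ C A B → (A ⊕ B) ⊛ C ≗ (A ⊛ C) ⊕ (B ⊛ C)
⊛-distribʳ-⊕ C A B zero = eq (A 0) (B 0) (C 0)
  where
  eq : ∀ a b c → (a + b) * c + 0ℤ ≡ a * c + 0ℤ + (b * c + 0ℤ)
  eq = ℤ.solve-∀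
⊛-distribʳ-⊕ C A B (suc n) =
  trans (cong ((A 0 + B 0) * C (suc n) +_) (⊛-distribʳ-⊕ C (A ∘ suc) (B ∘ suc) n))
        (eq (A 0) (B 0) (C (suc n)) _ _)
  where
  eq : ∀ a b c x y → (a + b) * c + (x + y) ≡ a * c + x + (b * c + y)
  eq = ℤ.solve-∀

⊛-scaleˡ : ∀ c A B → (λ n → c * A n) ⊛ B ≗ (λ n → c * (A ⊛ B) n)
⊛-scaleˡ c A B zero = eq c (A 0) (B 0)
  where
  eq : ∀ c a b → c * a * b + 0ℤ ≡ c * (a * b + 0ℤ)
  eq = ℤ.solve-∀
⊛-scaleˡ c A B (suc n) =
  trans (cong (c * A 0 * B (suc n) +_) (⊛-scaleˡ c (A ∘ suc) B n))
        (eq c (A 0) (B (suc n)) _)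
  where
  eq : ∀ c a b x → c * a * b + c * x ≡ c * (a * b + x)
  eq = ℤ.solve-∀

-- Splits off the last summand of the convolution, whereas `⊛` unfolds at the first; commutativity
-- needs both.
⊛-suc : ∀ A B n → (A ⊛ B) (suc n) ≡ (A ⊛ (B ∘ suc)) n + A (suc n) * B 0
⊛-suc A B zero = eq (A 0) (A 1) (B 0) (B 1)
  where
  eq : ∀ a a′ b b′ → a * b′ + (a′ * b + 0ℤ) ≡ a * b′ + 0ℤ + a′ * b
  eq = ℤ.solve-∀
⊛-suc A B (suc n) =
  trans (cong (A 0 * B (suc (suc n)) +_) (⊛-suc (A ∘ suc) B n))
        (sym (ℤ.+-assoc (A 0 * B (suc (suc n))) _ _))

⊛-comm : ∀ A B → A ⊛ B ≗ B ⊛ A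
⊛-comm A B zero    = cong (_+ 0ℤ) (ℤ.*-comm (A 0) (B 0))
⊛-comm A B (suc n) = begin
  A 0 * B (suc n) + ((A ∘ suc) ⊛ B) n
    ≡⟨ cong₂ _+_ (ℤ.*-comm (A 0) (B (suc n))) (⊛-comm (A ∘ suc) B n) ⟩
  B (suc n) * A 0 + (B ⊛ (A ∘ suc)) n
    ≡⟨ ℤ.+-comm (B (suc n) * A 0) _ ⟩
  (B ⊛ (A ∘ suc)) n + B (suc n) * A 0
    ≡⟨ ⊛-suc B A n ⟨
  (B ⊛ A) (suc n) ∎
  where open ≡-Reasoning

⊛-assoc : ∀ A B C → (A ⊛ B) ⊛ C ≗ A ⊛ (B ⊛ C)
⊛-assoc A B C zero = eq (A 0) (B 0) (C 0)
  where
  eq : ∀ a b c → (a * b + 0ℤ) * c + 0ℤ ≡ a * (b * c + 0ℤ) + 0ℤ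
  eq = ℤ.solve-∀
⊛-assoc A B C (suc n) = begin
  (A 0 * B 0 + 0ℤ) * C (suc n) + (((A ⊛ B) ∘ suc) ⊛ C) n
    -- By definition the tail of `A ⊛ B` is `A 0` times the tail of `B`, plus `(A ∘ suc) ⊛ B`.
    ≡⟨ cong ((A 0 * B 0 + 0ℤ) * C (suc n) +_)
         (⊛-distribʳ-⊕ C (λ k → A 0 * B (suc k)) ((A ∘ suc) ⊛ B) n) ⟩
  (A 0 * B 0 + 0ℤ) * C (suc n) + (((λ k → A 0 * B (suc k)) ⊛ C) n + (((A ∘ suc) ⊛ B) ⊛ C) n)
    ≡⟨ cong ((A 0 * B 0 + 0ℤ) * C (suc n) +_)
         (cong₂ _+_ (⊛-scaleˡ (A 0) (B ∘ suc) C n) (⊛-assoc (A ∘ suc) B C n)) ⟩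
  (A 0 * B 0 + 0ℤ) * C (suc n) + (A 0 * ((B ∘ suc) ⊛ C) n + ((A ∘ suc) ⊛ (B ⊛ C)) n)
    ≡⟨ eq (A 0) (B 0) (C (suc n)) _ _ ⟩
  A 0 * (B 0 * C (suc n) + ((B ∘ suc) ⊛ C) n) + ((A ∘ suc) ⊛ (B ⊛ C)) n ∎
  where
  open ≡-Reasoning
  eq : ∀ a b c x y → (a * b + 0ℤ) * c + (a * x + y) ≡ a * (b * c + x) + y
  eq = ℤ.solve-∀

⊛-identityʳ : ∀ A → A ⊛ q^ 0 ≗ A
⊛-identityʳ A n = ⊛-truncated-identityʳ A (q^ 0) n (λ _ _ → refl)

⊛-identityˡ : ∀ A → q^ 0 ⊛ A ≗ A
⊛-identityˡ A n = trans (⊛-comm (q^ 0) A n) (⊛-identityʳ A n)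

⊛-distribˡ-⊕ : ∀ C A B → C ⊛ (A ⊕ B) ≗ (C ⊛ A) ⊕ (C ⊛ B)
⊛-distribˡ-⊕ C A B n = begin
  (C ⊛ (A ⊕ B)) n          ≡⟨ ⊛-comm C (A ⊕ B) n ⟩
  ((A ⊕ B) ⊛ C) n          ≡⟨ ⊛-distribʳ-⊕ C A B n ⟩
  (A ⊛ C) n + (B ⊛ C) n    ≡⟨ cong₂ _+_ (⊛-comm A C n) (⊛-comm B C n) ⟩
  (C ⊛ A) n + (C ⊛ B) n    ∎
  where open ≡-Reasoning

seriesRing : CommutativeRing _ _
seriesRing = record
  { Carrier = Series
  ; _≈_ = _≗_
  ; _+_ = _⊕_
  ; _*_ = _⊛_
  ; -_  = λ A n → - A n
  ; 0#  = λ _ → 0ℤ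
  ; 1#  = q^ 0
  ; isCommutativeRing = record
    { isRing = record
      { +-isAbelianGroup = Pointwise.isAbelianGroup ℕ ℤ.+-0-isAbelianGroup
      ; *-cong = ⊛-cong
      ; *-assoc = ⊛-assoc
      ; *-identity = ⊛-identityˡ , ⊛-identityʳ
      ; distrib = ⊛-distribˡ-⊕ , ⊛-distribʳ-⊕
      }
    ; *-comm = ⊛-comm
    }
  }

module SR = CommutativeRing seriesRing

open Exp SR.semiring using (_^_; ^-assocʳ)
open IntegerCoefficients.Solver seriesRing using (solve; con; _:+_; _:*_; _:-_; :-_; _:=_)

-- Monomials and quotients of series.

q^-⊛-shift : ∀ m A n → (q^ m ⊛ A) (m ℕ.+ n) ≡ A n
q^-⊛-shift zero    A n = ⊛-identityˡ A n
-- `q^ suc m` has constant term 0 and tail `q^ m`, both definitionally, so only the tail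
-- contributes.
q^-⊛-shift (suc m) A n = trans (ℤ.+-identityˡ _) (q^-⊛-shift m A n)

q^-⊛-below : ∀ m A {n} → n ℕ.< m → (q^ m ⊛ A) n ≡ 0ℤ
q^-⊛-below (suc m) A {zero}  _         = refl
q^-⊛-below (suc m) A {suc n} (s≤s n<m) = trans (ℤ.+-identityˡ _) (q^-⊛-below m A n<m)

q^-homo-⊛ : ∀ m n → q^ (m ℕ.+ n) ≗ q^ m ⊛ q^ n
q^-homo-⊛ zero    n k       = sym (⊛-identityˡ (q^ n) k)
q^-homo-⊛ (suc m) n zero    = refl
q^-homo-⊛ (suc m) n (suc k) = trans (q^-homo-⊛ m n k) (sym (ℤ.+-identityˡ _))

^≗q^ : ∀ n → (q^ 1) ^ n ≗ q^ n
^≗q^ zero    k = refl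
^≗q^ (suc n) k = trans (⊛-cong {A = q^ 1} (λ _ → refl) (^≗q^ n) k) (sym (q^-homo-⊛ 1 n k))

⊘-cong-at : ∀ A A′ B B′ n → A ≈[ n ] A′ → B ≈[ n ] B′ → (A ⊘ B) n ≡ (A′ ⊘ B′) n
⊘-cong-at A A′ B B′ zero    A≈A′ B≈B′ = A≈A′ 0 z≤n
⊘-cong-at A A′ B B′ (suc n) A≈A′ B≈B′ =
  ⊘-cong-at (remainder A B) (remainder A′ B′) B B′ n
    (λ i i≤n → cong₂ _-_ (A≈A′ (suc i) (s≤s i≤n))
                          (cong₂ _*_ (A≈A′ 0 z≤n) (B≈B′ (suc i) (s≤s i≤n))))
    (≈-init B≈B′)

⊘-cong : ∀ {A A′ B B′} → A ≗ A′ → B ≗ B′ → A ⊘ B ≗ A′ ⊘ B′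
⊘-cong A≗A′ B≗B′ n = ⊘-cong-at _ _ _ _ n (λ i _ → A≗A′ i) (λ i _ → B≗B′ i)

-- Multiplying the iterated quotient by C and then by B gives back A; uniqueness of the quotient
-- concludes.
⊘-⊛ : ∀ A B C → B 0 ≡ 1ℤ → C 0 ≡ 1ℤ → A ⊘ (B ⊛ C) ≗ (A ⊘ B) ⊘ C
⊘-⊛ A B C B₀≡1 C₀≡1 n = sym (⊘-unique X A (B ⊛ C) BC₀≡1 X⊛BC≗A n)
  where
  open ≡-Reasoning
  X = (A ⊘ B) ⊘ C
  BC₀≡1 : (B ⊛ C) 0 ≡ 1ℤ
  BC₀≡1 = trans (ℤ.+-identityʳ _) (cong₂ _*_ B₀≡1 C₀≡1)
  X⊛BC≗A : X ⊛ (B ⊛ C) ≗ A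
  X⊛BC≗A k = begin
    (X ⊛ (B ⊛ C)) k   ≡⟨ ⊛-cong {A = X} (λ _ → refl) (⊛-comm B C) k ⟩
    (X ⊛ (C ⊛ B)) k   ≡⟨ ⊛-assoc X C B k ⟨
    ((X ⊛ C) ⊛ B) k   ≡⟨ ⊛-cong {B = B} (⊘-inverse (A ⊘ B) C C₀≡1) (λ _ → refl) k ⟩
    ((A ⊘ B) ⊛ B) k   ≡⟨ ⊘-inverse A B B₀≡1 k ⟩
    A k               ∎

⊘-[1-q^]-rec : ∀ A m → (A ⊘ (q^ 0 ⊖ q^ suc m)) ≗ A ⊕ (q^ suc m ⊛ (A ⊘ (q^ 0 ⊖ q^ suc m)))
⊘-[1-q^]-rec A m n = begin
  Y n                                         ≡⟨ eq (Y n) ((q^ suc m ⊛ Y) n) ⟩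
  Y n - (q^ suc m ⊛ Y) n + (q^ suc m ⊛ Y) n   ≡⟨ cong (_+ (q^ suc m ⊛ Y) n) Y-Yq≡A ⟩
  A n + (q^ suc m ⊛ Y) n                      ∎
  where
  open ≡-Reasoning
  Y = A ⊘ (q^ 0 ⊖ q^ suc m)
  eq : ∀ x y → x ≡ x - y + y
  eq = ℤ.solve-∀
  Y-Yq≡A : Y n - (q^ suc m ⊛ Y) n ≡ A n
  Y-Yq≡A = begin
    (Y ⊖ q^ suc m ⊛ Y) n
      ≡⟨ solve 2 (λ Y x → Y :- x :* Y := Y :* (con 1ℤ :- x)) (λ _ → refl) Y (q^ suc m) n ⟩
    (Y ⊛ (q^ 0 ⊖ q^ suc m)) n
      ≡⟨ ⊘-inverse A (q^ 0 ⊖ q^ suc m) refl n ⟩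
    A n ∎

-- Division by `f d` along a residue class modulo d.

Absorbs : (W V : ℤ → Set) → Set
Absorbs W V = ∀ x y → W x → V y → V (x + y)

-- The shift d(k + 1) preserves the residue class. Along it the first k + 1 entries of the quotient
-- are those of `A`; each later one adds an entry of `A`, satisfying `W`, to an earlier entry of the
-- quotient, satisfying `V`.
⊘-[1-q^]-residue : ∀ (W V : ℤ → Set) → Absorbs W V →
  ∀ d .{{_ : NonZero d}} k A r → r ℕ.< d →
  (∀ n → n ℕ.≤ k → V (A (d ℕ.* n ℕ.+ r))) → (∀ n → W (A (d ℕ.* n ℕ.+ r))) →
  ∀ n → V ((A ⊘ (q^ 0 ⊖ q^ (d ℕ.* suc k))) (d ℕ.* n ℕ.+ r))
⊘-[1-q^]-residue W V W+V d@(suc d-1) k A r r<d V-init W-all = <-rec _ step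
  where
  open ≡-Reasoning
  -- Chosen so that `suc m` is definitionally `d ℕ.* suc k`.
  m = k ℕ.+ d-1 ℕ.* suc k
  Y = A ⊘ (q^ 0 ⊖ q^ suc m)
  step : ∀ n → (∀ {i} → i ℕ.< n → V (Y (d ℕ.* i ℕ.+ r))) → V (Y (d ℕ.* n ℕ.+ r))
  step n ih with n ℕ.≤? k
  ... | yes n≤k = subst V (sym (begin
      Y (d ℕ.* n ℕ.+ r)
        ≡⟨ ⊘-[1-q^]-rec A m (d ℕ.* n ℕ.+ r) ⟩
      A (d ℕ.* n ℕ.+ r) + (q^ suc m ⊛ Y) (d ℕ.* n ℕ.+ r)
        ≡⟨ cong (A (d ℕ.* n ℕ.+ r) +_) (q^-⊛-below (suc m) Y below) ⟩
      A (d ℕ.* n ℕ.+ r) + 0ℤ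
        ≡⟨ ℤ.+-identityʳ _ ⟩
      A (d ℕ.* n ℕ.+ r) ∎)) (V-init n n≤k)
    where
    below : d ℕ.* n ℕ.+ r ℕ.< d ℕ.* suc k
    below = ℕ.<-≤-trans (ℕ.+-monoʳ-< (d ℕ.* n) r<d)
      (ℕ.≤-trans (ℕ.≤-reflexive (trans (ℕ.+-comm (d ℕ.* n) d) (sym (ℕ.*-suc d n))))
                 (ℕ.*-monoʳ-≤ d (s≤s n≤k)))
  ... | no n≰k with ℕ.m≤n⇒∃[o]m+o≡n (ℕ.≰⇒> n≰k)
  ...   | i , refl = subst V (sym (begin
      Y (d ℕ.* (suc k ℕ.+ i) ℕ.+ r)
        ≡⟨ ⊘-[1-q^]-rec A m _ ⟩
      A (d ℕ.* (suc k ℕ.+ i) ℕ.+ r) + (q^ suc m ⊛ Y) (d ℕ.* (suc k ℕ.+ i) ℕ.+ r)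
        ≡⟨ cong (λ j → A (d ℕ.* (suc k ℕ.+ i) ℕ.+ r) + (q^ suc m ⊛ Y) j) split ⟩
      A (d ℕ.* (suc k ℕ.+ i) ℕ.+ r) + (q^ suc m ⊛ Y) (suc m ℕ.+ (d ℕ.* i ℕ.+ r))
        ≡⟨ cong (A (d ℕ.* (suc k ℕ.+ i) ℕ.+ r) +_) (q^-⊛-shift (suc m) Y _) ⟩
      A (d ℕ.* (suc k ℕ.+ i) ℕ.+ r) + Y (d ℕ.* i ℕ.+ r) ∎))
      (W+V _ _ (W-all (suc k ℕ.+ i)) (ih (s≤s (ℕ.m≤n+m i k))))
    where
    split : d ℕ.* (suc k ℕ.+ i) ℕ.+ r ≡ d ℕ.* suc k ℕ.+ (d ℕ.* i ℕ.+ r)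
    split = trans (cong (ℕ._+ r) (ℕ.*-distribˡ-+ d (suc k) i)) (ℕ.+-assoc (d ℕ.* suc k) _ r)

-- The constant term is already stable at the empty product.
partialProduct-constant : ∀ d .{{_ : NonZero d}} N → partialProduct d N 0 ≡ 1ℤ
partialProduct-constant d N =
  subst (λ k → partialProduct d k 0 ≡ 1ℤ) (ℕ.+-identityʳ N) (f-stable d 0 N)

partialProduct≈f : ∀ d .{{_ : NonZero d}} {n N} → n ℕ.≤ N → partialProduct d N ≈[ n ] f d
partialProduct≈f d {N = N} n≤N i i≤n =
  subst (λ k → partialProduct d k i ≡ f d i) (ℕ.m∸n+n≡m (ℕ.≤-trans i≤n n≤N)) (f-stable d i (N ℕ.∸ i))

⊘-partialProduct-residue : ∀ (W V : ℤ → Set) → Absorbs W V → Absorbs V V →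
  ∀ d .{{_ : NonZero d}} A r → r ℕ.< d →
  V (A (d ℕ.* 0 ℕ.+ r)) → (∀ n → W (A (d ℕ.* n ℕ.+ r))) →
  ∀ N n → V ((A ⊘ partialProduct d (suc N)) (d ℕ.* n ℕ.+ r))
⊘-partialProduct-residue W V W+V V+V d A r r<d V-first W-all zero n =
  subst V (⊘-cong {A = A} (λ _ → refl) (sym ∘ ⊛-identityˡ (q^ 0 ⊖ q^ (d ℕ.* 1))) (d ℕ.* n ℕ.+ r))
    -- With k = 0 the quotient consists of partial sums along the class, so `V` of the first entry
    -- alone upgrades `W` to `V` everywhere.
    (⊘-[1-q^]-residue W V W+V d 0 A r r<d (λ { zero z≤n → V-first }) W-all n)
⊘-partialProduct-residue W V W+V V+V d@(suc _) A r r<d V-first W-all (suc N) n =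
  subst V (sym (⊘-⊛ A (partialProduct d (suc N)) (q^ 0 ⊖ q^ (d ℕ.* suc (suc N)))
                  (partialProduct-constant d (suc N)) refl (d ℕ.* n ℕ.+ r)))
    (⊘-[1-q^]-residue V V V+V d (suc N) (A ⊘ partialProduct d (suc N)) r r<d (λ i _ → ih i) ih n)
  where ih = ⊘-partialProduct-residue W V W+V V+V d A r r<d V-first W-all N

⊘-f-residue : ∀ (W V : ℤ → Set) → Absorbs W V → Absorbs V V →
  ∀ d .{{_ : NonZero d}} A r → r ℕ.< d →
  V (A (d ℕ.* 0 ℕ.+ r)) → (∀ n → W (A (d ℕ.* n ℕ.+ r))) →
  ∀ n → V ((A ⊘ f d) (d ℕ.* n ℕ.+ r))
⊘-f-residue W V W+V V+V d A r r<d V-first W-all n =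
  -- The coefficient at `N` sees the divisor only up to q^N. `suc N` factors are taken because the
  -- upgrade to `V` needs at least one.
  subst V (⊘-cong-at A A _ _ N (λ _ _ → refl) (partialProduct≈f d (ℕ.n≤1+n N)))
    (⊘-partialProduct-residue W V W+V V+V d A r r<d V-first W-all N n)
  where N = d ℕ.* n ℕ.+ r

-- Gauss's identity for power series.

X : Series
X = q^ 1

open Gauss seriesRing X

1-X*X^≗1-q^ : ∀ n → q^ 0 SR.- X ⊛ X ^ n ≗ q^ 0 ⊖ q^ suc n
1-X*X^≗1-q^ n i = cong (λ y → (q^ 0) i - y) (^≗q^ (suc n) i)

partialProduct₁≗poch : ∀ n → partialProduct 1 n ≗ poch X n
partialProduct₁≗poch zero    i = refl
partialProduct₁≗poch (suc n) i = trans
  (⊛-cong (partialProduct₁≗poch n)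
     (λ j → trans (cong (λ k → (q^ 0 ⊖ q^ k) j) (ℕ.*-identityˡ (suc n))) (sym (1-X*X^≗1-q^ n j))) i)
  (sym (poch-last X n i))

-- Factorwise this is 1 - q²ⁱ = (1 - qⁱ)(1 + qⁱ).
partialProduct₂≗poch : ∀ n → partialProduct 2 n ≗ poch X n ⊛ poch (SR.- X) n
partialProduct₂≗poch zero    = SR.sym (⊛-identityˡ (q^ 0))
partialProduct₂≗poch (suc n) = begin
  partialProduct 2 n ⊛ (q^ 0 ⊖ q^ (2 ℕ.* suc n))
    ≈⟨ ⊛-cong (partialProduct₂≗poch n) (λ i → cong (λ y → (q^ 0) i - y) (q^-double i)) ⟩
  (P ⊛ M) ⊛ (q^ 0 SR.- (X ⊛ X ^ n) ⊛ (X ⊛ X ^ n))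
    ≈⟨ solve 4 (λ p m x y → let one = con 1ℤ in
         (p :* m) :* (one :- (x :* y) :* (x :* y))
         := (p :* (one :- x :* y)) :* (m :* (one :- (:- x) :* y)))
         SR.refl P M X (X ^ n) ⟩
  (P ⊛ (q^ 0 SR.- X ⊛ X ^ n)) ⊛ (M ⊛ (q^ 0 SR.- (SR.- X) ⊛ X ^ n))
    ≈⟨ ⊛-cong (poch-last X n) (poch-last (SR.- X) n) ⟨
  poch X (suc n) ⊛ poch (SR.- X) (suc n) ∎
  where
  open SetoidReasoning SR.setoid
  P = poch X n
  M = poch (SR.- X) n
  q^-double : q^ (2 ℕ.* suc n) ≗ (X ⊛ X ^ n) ⊛ (X ⊛ X ^ n)
  q^-double = begin
    q^ (2 ℕ.* suc n)              ≡⟨ cong (λ k → q^ (suc n ℕ.+ k)) (ℕ.+-identityʳ (suc n)) ⟩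
    q^ (suc n ℕ.+ suc n)          ≈⟨ q^-homo-⊛ (suc n) (suc n) ⟩
    q^ suc n ⊛ q^ suc n           ≈⟨ ⊛-cong (^≗q^ (suc n)) (^≗q^ (suc n)) ⟨
    (X ⊛ X ^ n) ⊛ (X ⊛ X ^ n)     ∎

-- Ramanujan's theta function φ(-q).
φ : Series
φ = (f 1 ⊛ f 1) ⊘ f 2

-- Split the product into ∏(1 + qⁱ) and ∏(1 - qⁱ). By the finite identity the square sum times the
-- former is congruent to f₁ modulo qⁿ⁺¹, and so is the latter.
squareSum-⊛-partialProduct : ∀ n → (squareSum n ⊛ partialProduct 2 n) ≈[ n ] (f 1 ⊛ f 1)
squareSum-⊛-partialProduct n i i≤n with squareSum-mod n
... | e , sum-eq = begin
  (squareSum n ⊛ partialProduct 2 n) i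
    ≡⟨ SR.*-congˡ {squareSum n} (partialProduct₂≗poch n) i ⟩
  (squareSum n ⊛ (poch X n ⊛ poch (SR.- X) n)) i
    ≡⟨ solve 3 (λ s p m → s :* (p :* m) := s :* m :* p) SR.refl
         (squareSum n) (poch X n) (poch (SR.- X) n) i ⟩
  (squareSum n ⊛ poch (SR.- X) n ⊛ poch X n) i
    ≡⟨ ⊛-cong-at _ _ _ _ i (≈-mono i≤n squareSum-⊛-poch≈f₁) (≈-mono i≤n poch≈f₁) ⟩
  (f 1 ⊛ f 1) i ∎
  where
  open ≡-Reasoning
  poch≈f₁ : poch X n ≈[ n ] f 1
  poch≈f₁ j j≤n = trans (sym (partialProduct₁≗poch n j)) (partialProduct≈f 1 ℕ.≤-refl j j≤n)
  squareSum-⊛-poch≈f₁ : (squareSum n ⊛ poch (SR.- X) n) ≈[ n ] f 1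
  squareSum-⊛-poch≈f₁ j j≤n = begin
    (squareSum n ⊛ poch (SR.- X) n) j     ≡⟨ sum-eq j ⟩
    poch X n j + (X ^ suc n ⊛ e) j        ≡⟨ cong (poch X n j +_) (SR.*-congʳ {e} (^≗q^ (suc n)) j) ⟩
    poch X n j + (q^ suc n ⊛ e) j         ≡⟨ cong (poch X n j +_) (q^-⊛-below (suc n) e (s≤s j≤n)) ⟩
    poch X n j + 0ℤ                       ≡⟨ ℤ.+-identityʳ _ ⟩
    poch X n j                            ≡⟨ poch≈f₁ j j≤n ⟩
    f 1 j                                 ∎

-- Long division obtains the coefficient of qⁿ from coefficients up to n only, so the congruence
-- modulo qⁿ⁺¹ suffices.
φ≡squareSum : ∀ n → φ n ≡ squareSum n n
φ≡squareSum n = begin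
  ((f 1 ⊛ f 1) ⊘ f 2) n
    ≡⟨ ⊘-cong-at _ _ _ _ n (squareSum-⊛-partialProduct n) (partialProduct≈f 2 ℕ.≤-refl) ⟨
  ((squareSum n ⊛ partialProduct 2 n) ⊘ partialProduct 2 n) n
    ≡⟨ ⊘-unique (squareSum n) _ (partialProduct 2 n) (partialProduct-constant 2 n) (λ _ → refl) n ⟨
  squareSum n n ∎
  where open ≡-Reasoning

-- Weak signs of `φ` on residue classes modulo 4.

q^-nonneg : ∀ m n → 0ℤ ≤ (q^ m) n
q^-nonneg m n with does (m ℕ.≟ n)
... | true  = +≤+ z≤n
... | false = ℤ.≤-refl

q^-off-residue : ∀ {d r s} .{{_ : NonZero d}} → r ℕ.< d → s ℕ.< d → r ≢ s →
  ∀ m n → (q^ (d ℕ.* m ℕ.+ s)) (d ℕ.* n ℕ.+ r) ≡ 0ℤ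
q^-off-residue {d} {r} {s} r<d s<d r≢s m n =
  cong (λ b → if b then 1ℤ else 0ℤ)
    (dec-false (d ℕ.* m ℕ.+ s ℕ.≟ d ℕ.* n ℕ.+ r)
      (λ eq → r≢s (trans (sym (residue n r<d)) (trans (cong (_% d) (sym eq)) (residue m s<d)))))
  where
  residue : ∀ k {t} → t ℕ.< d → (d ℕ.* k ℕ.+ t) % d ≡ t
  residue k {t} t<d = trans
    (cong (_% d) (trans (ℕ.+-comm (d ℕ.* k) t) (cong (t ℕ.+_) (ℕ.*-comm d k))))
    (trans ([m+kn]%n≡m%n t k d) (m<n⇒m%n≡m t<d))

X^^≗q^ : ∀ k → (X ^ k) ^ k ≗ q^ (k ℕ.* k)
X^^≗q^ k = SR.trans (^-assocʳ X k k) (^≗q^ (k ℕ.* k))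

-- The exponent keeps the form 4m + 0, which exhibits its residue as `weakSign-q^` expects.
signedSquare-even : ∀ l → signedSquare (l ℕ.* 2) ≗ q^ (4 ℕ.* (l ℕ.* l) ℕ.+ 0)
signedSquare-even l = begin
  (SR.- (X ^ (l ℕ.* 2))) ^ (l ℕ.* 2)   ≈⟨ -‿^-even (X ^ (l ℕ.* 2)) l ⟩
  (X ^ (l ℕ.* 2)) ^ (l ℕ.* 2)          ≈⟨ X^^≗q^ (l ℕ.* 2) ⟩
  q^ (l ℕ.* 2 ℕ.* (l ℕ.* 2))           ≡⟨ cong q^_ (eq l) ⟩
  q^ (4 ℕ.* (l ℕ.* l) ℕ.+ 0)           ∎
  where
  open SetoidReasoning SR.setoid
  eq : ∀ l → l ℕ.* 2 ℕ.* (l ℕ.* 2) ≡ 4 ℕ.* (l ℕ.* l) ℕ.+ 0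
  eq = ℕ.solve-∀

signedSquare-odd : ∀ l → let k = suc (l ℕ.* 2) in
  signedSquare k ≗ SR.- (q^ (4 ℕ.* (l ℕ.* l ℕ.+ l) ℕ.+ 1))
signedSquare-odd l = begin
  (SR.- (X ^ k)) ⊛ (SR.- (X ^ k)) ^ (l ℕ.* 2)
    ≈⟨ SR.*-congˡ {SR.- (X ^ k)} (-‿^-even (X ^ k) l) ⟩
  (SR.- (X ^ k)) ⊛ (X ^ k) ^ (l ℕ.* 2)
    ≈⟨ solve 2 (λ x y → (:- x) :* y := :- (x :* y)) SR.refl (X ^ k) ((X ^ k) ^ (l ℕ.* 2)) ⟩
  SR.- ((X ^ k) ^ k)
    ≈⟨ SR.-‿cong (X^^≗q^ k) ⟩
  SR.- (q^ (k ℕ.* k))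
    ≡⟨ cong (λ m → SR.- (q^ m)) (eq l) ⟩
  SR.- (q^ (4 ℕ.* (l ℕ.* l ℕ.+ l) ℕ.+ 1)) ∎
  where
  open SetoidReasoning SR.setoid
  k = suc (l ℕ.* 2)
  eq : ∀ l → suc (l ℕ.* 2) ℕ.* suc (l ℕ.* 2) ≡ 4 ℕ.* (l ℕ.* l ℕ.+ l) ℕ.+ 1
  eq = ℕ.solve-∀

-- Indexed by the residue r, so that one argument serves all four classes.
WeakSign : ℕ → ℤ → Set
WeakSign 0 x = 0ℤ ≤ x
WeakSign 1 x = x ≤ 0ℤ
WeakSign _ x = x ≡ 0ℤ

weakSign-0 : ∀ r → WeakSign r 0ℤ
weakSign-0 0             = ℤ.≤-refl
weakSign-0 1             = ℤ.≤-refl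
weakSign-0 (suc (suc _)) = refl

weakSign-+ : ∀ r → Absorbs (WeakSign r) (WeakSign r)
weakSign-+ 0             _ _ = ℤ.+-mono-≤
weakSign-+ 1             _ _ = ℤ.+-mono-≤
weakSign-+ (suc (suc _)) _ _ = cong₂ _+_

weakSign-q^ : ∀ m r → r ℕ.< 4 → ∀ n → WeakSign r ((q^ (4 ℕ.* m ℕ.+ 0)) (4 ℕ.* n ℕ.+ r))
weakSign-q^ m zero      r<4 n = q^-nonneg (4 ℕ.* m ℕ.+ 0) (4 ℕ.* n ℕ.+ 0)
weakSign-q^ m r@(suc _) r<4 n =
  subst (WeakSign r) (sym (q^-off-residue r<4 (s≤s z≤n) (λ ()) m n)) (weakSign-0 r)

weakSign-−q^ : ∀ m r → r ℕ.< 4 → ∀ n → WeakSign r (- (q^ (4 ℕ.* m ℕ.+ 1)) (4 ℕ.* n ℕ.+ r))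
weakSign-−q^ m 1 r<4 n = ℤ.neg-mono-≤ (q^-nonneg (4 ℕ.* m ℕ.+ 1) (4 ℕ.* n ℕ.+ 1))
weakSign-−q^ m 0 r<4 n =
  subst (WeakSign 0) (cong -_ (sym (q^-off-residue {s = 1} r<4 (s≤s (s≤s z≤n)) (λ ()) m n))) (weakSign-0 0)
weakSign-−q^ m r@(suc (suc _)) r<4 n =
  subst (WeakSign r) (cong -_ (sym (q^-off-residue r<4 (s≤s (s≤s z≤n)) (λ ()) m n))) (weakSign-0 r)

weakSign-signedSquare : ∀ k r → r ℕ.< 4 → ∀ n → WeakSign r (signedSquare k (4 ℕ.* n ℕ.+ r))
weakSign-signedSquare k r r<4 n with k divMod 2
... | result l zero refl =
  subst (WeakSign r) (sym (signedSquare-even l (4 ℕ.* n ℕ.+ r))) (weakSign-q^ (l ℕ.* l) r r<4 n)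
... | result l (suc zero) refl =
  subst (WeakSign r) (sym (signedSquare-odd l (4 ℕ.* n ℕ.+ r))) (weakSign-−q^ (l ℕ.* l ℕ.+ l) r r<4 n)

weakSign-squareSum : ∀ N r → r ℕ.< 4 → ∀ n → WeakSign r (squareSum N (4 ℕ.* n ℕ.+ r))
-- The term for k = 0 is `q^ 0`, whose exponent is 4 · 0 + 0.
weakSign-squareSum zero    r r<4 n = weakSign-q^ 0 r r<4 n
weakSign-squareSum (suc N) r r<4 n =
  weakSign-+ r _ _ (weakSign-squareSum N r r<4 n) (weakSign-+ r _ _ t t)
  where t = weakSign-signedSquare (suc N) r r<4 n

weakSign-φ : ∀ r → r ℕ.< 4 → ∀ n → WeakSign r (φ (4 ℕ.* n ℕ.+ r))
weakSign-φ r r<4 n =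
  subst (WeakSign r) (sym (φ≡squareSum (4 ℕ.* n ℕ.+ r))) (weakSign-squareSum (4 ℕ.* n ℕ.+ r) r r<4 n)

-- Strict signs after division by `f 4`.

StrictSign : ℕ → ℤ → Set
StrictSign 0 x = 0ℤ < x
StrictSign 1 x = x < 0ℤ
StrictSign _ x = x ≡ 0ℤ

weak+strict : ∀ r → Absorbs (WeakSign r) (StrictSign r)
weak+strict 0             _ _ = ℤ.+-mono-≤-<
weak+strict 1             _ _ = ℤ.+-mono-≤-<
weak+strict (suc (suc _)) _ _ = cong₂ _+_

strict+strict : ∀ r → Absorbs (StrictSign r) (StrictSign r)
strict+strict 0             _ _ = ℤ.+-mono-<
strict+strict 1             _ _ = ℤ.+-mono-<
strict+strict (suc (suc _)) _ _ = cong₂ _+_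

strictSign-φ : ∀ r → r ℕ.< 4 → StrictSign r (φ r)
-- The values φ₀ = 1 and φ₁ = -2 are found by evaluation.
strictSign-φ 0               _   = +<+ (s≤s z≤n)
strictSign-φ 1               _   = -<+
strictSign-φ r@(suc (suc _)) r<4 = weakSign-φ r r<4 0

strictSign-a : ∀ r → r ℕ.< 4 → ∀ n → StrictSign r (a (4 ℕ.* n ℕ.+ r))
strictSign-a r r<4 n = subst (StrictSign r)
  -- Rewrites `a` as `φ ⊘ f 4`; the constant terms of `f 2` and `f 4` evaluate to 1.
  (sym (⊘-⊛ (f 1 ⊛ f 1) (f 2) (f 4) refl refl (4 ℕ.* n ℕ.+ r)))
  (⊘-f-residue (WeakSign r) (StrictSign r) (weak+strict r) (strict+strict r)
     4 φ r r<4 (strictSign-φ r r<4) (weakSign-φ r r<4) n)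

theorem4p6 : ∀ (n : ℕ) →
    a (4 ℕ.* n) > 0ℤ ×
    a (4 ℕ.* n ℕ.+ 1) < 0ℤ ×
    a (4 ℕ.* n ℕ.+ 2) ≡ 0ℤ ×
    a (4 ℕ.* n ℕ.+ 3) ≡ 0ℤ
theorem4p6 n =
  subst (λ m → a m > 0ℤ) (ℕ.+-identityʳ (4 ℕ.* n)) (strictSign-a 0 (s≤s z≤n) n) ,
  strictSign-a 1 (s≤s (s≤s z≤n)) n ,
  strictSign-a 2 (s≤s (s≤s (s≤s z≤n))) n ,
  strictSign-a 3 (s≤s (s≤s (s≤s (s≤s z≤n)))) n
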